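{- Let $m\ge n \ge 3$ be integers. Then $$a_1(C_n \,\square\, C_m) = \begin{cases} 1; & n = m = 3,\\ 2; & n = 3,\ m = 4,\\ 3; & n = 3,\ m \ge 5,\\ 4; & m\ge n\ge 4, \end{cases}$$ and $$a_1'(C_n \,\square\, C_m) = \begin{cases} 1; & n = m = 3,\\ 3; & n = 3,\ m\ge 4,\\ 4; & m\ge n\ge 4. \end{cases}$$
   Context: $C_n$ is the cycle on $n$ vertices. The Cartesian product $G\,\square\, H$ of graphs $G$ and $H$ has vertex set $V(G)\times V(H)$, with $(g,h)$ and $(g',h')$ adjacent if either $gg'\in E(G)$ and $h=h'$, or $g=g'$ and $hh'\in E(H)$. A clique of a graph $G$ is an inclusion-wise maximal complete subgraph. The $(a,b)$-monochromatic clique transversal game ($(a,b)$-MCT game) on $G$ is played by Alice and Bob, who alternately take turns: in each of her turns Alice chooses $a$ unplayed vertices and colors them red, and in each of his turns Bob chooses $b$ unplayed vertices and colors them blue (if fewer unplayed vertices remain, the player colors all of them). Alice wins if the red vertices contain at least one vertex of each clique of $G$; Bob wins if all vertices of some clique of $G$ are blue. The game is Alice-start or Bob-start depending on who moves first. The threshold $a_1(G)$ (resp. $a_1'(G)$) is the smallest positive integer $a$ such that Alice has a winning strategy in the Alice-start (resp. Bob-start) $(a,1)$-MCT game on $G$. -}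

module Defs where

open import Data.Nat using (ℕ; suc; _≤_; _<_; s≤s)
open import Data.Nat.Properties using (1+n≢n)
open import Data.Fin using (Fin; toℕ)
open import Data.List using (List; []; _++_; length; allFin; cartesianProduct)
open import Data.List.Membership.Propositional using (_∈_; _∉_)
open import Data.List.Membership.Propositional.Properties
  using (∈-allFin; ∈-cartesianProduct⁺)
open import Data.List.Relation.Binary.Subset.Propositional using (_⊆_)
open import Data.List.Relation.Unary.All using (All)
open import Data.List.Relation.Unary.Any using (Any)
open import Data.List.Relation.Unary.Enumerates.Setoid using (IsEnumeration)
open import Data.List.Relation.Unary.Unique.Propositional using (Unique)
open import Data.Product using (_×_; _,_; ∃-syntax)
open import Data.Sum using (_⊎_; inj₁; inj₂; swap)
open import Relation.Binary using (Rel; Irreflexive; Symmetric)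
open import Relation.Binary.PropositionalEquality
  using (_≡_; _≢_; refl; sym; trans; cong; setoid)
open import Relation.Nullary using (¬_)
open import Level using (0ℓ)

record Graph : Set₁ where
  field
    V           : Set
    Adj         : Rel V 0ℓ
    irrefl      : Irreflexive _≡_ Adj
    symm        : Symmetric Adj
    vertices    : List V
    enumeration : IsEnumeration (setoid V) vertices

Next : ∀ {n} → Rel (Fin n) 0ℓ
Next {n} i j = suc (toℕ i) ≡ toℕ j ⊎ (suc (toℕ i) ≡ n × toℕ j ≡ 0)

private
  Next-irrefl : ∀ {n} → 3 ≤ n → (i : Fin n) → ¬ Next i i
  Next-irrefl _ i (inj₁ e) = 1+n≢n e
  Next-irrefl {n} 3≤n i (inj₂ (e , z))
    with 3≤n | trans (sym e) (cong suc z)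
  ... | s≤s () | refl

cycle : (n : ℕ) → 3 ≤ n → Graph
cycle n 3≤n = record
  { V           = Fin n
  ; Adj         = λ i j → Next i j ⊎ Next j i
  ; irrefl      = λ { {i} refl (inj₁ e) → Next-irrefl 3≤n i e
                    ; {i} refl (inj₂ e) → Next-irrefl 3≤n i e }
  ; symm        = swap
  ; vertices    = allFin n
  ; enumeration = ∈-allFin
  }

infixr 7 _□_

_□_ : Graph → Graph → Graph
G □ H = record
  { V           = G.V × H.V
  ; Adj         = λ { (g , h) (g′ , h′) →
                      (G.Adj g g′ × h ≡ h′) ⊎ (g ≡ g′ × H.Adj h h′) }
  ; irrefl      = λ { refl (inj₁ (e , _)) → G.irrefl refl e
                    ; refl (inj₂ (_ , e)) → H.irrefl refl e }
  ; symm        = λ { (inj₁ (e , p)) → inj₁ (G.symm e , sym p)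
                    ; (inj₂ (p , e)) → inj₂ (sym p , H.symm e) }
  ; vertices    = cartesianProduct G.vertices H.vertices
  ; enumeration = λ { (g , h) → ∈-cartesianProduct⁺ (G.enumeration g) (H.enumeration h) }
  }
  where
  module G = Graph G
  module H = Graph H

data Player : Set where
  alice bob : Player

-- Sets of vertices are represented by lists; order and repetitions are
-- immaterial except in LegalMove, where Unique makes length the cardinality.

module _ (G : Graph) where
  open Graph G

  Complete : List V → Set
  Complete C = ∀ {u v} → u ∈ C → v ∈ C → u ≢ v → Adj u v

  IsClique : List V → Set
  IsClique C = Complete C × (∀ D → Complete D → C ⊆ D → D ⊆ C)

  record Position : Set where
    constructor position
    field
      red blue : List V

  open Position

  start : Position
  start = position [] []

  Unplayed : Position → V → Set
  Unplayed p v = v ∉ red p × v ∉ blue p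

  LegalMove : ℕ → Position → List V → Set
  LegalMove k p S =
    Unique S × All (Unplayed p) S ×
    (length S ≡ k ⊎ (length S < k × (∀ v → Unplayed p v → v ∈ S)))

  AliceWon : Position → Set
  AliceWon p = ∀ C → IsClique C → Any (_∈ red p) C

  BobWon : Position → Set
  BobWon p = ∃[ C ] IsClique C × All (_∈ blue p) C

  colourRed colourBlue : List V → Position → Position
  colourRed  S (position R B) = position (S ++ R) B
  colourBlue S (position R B) = position R (S ++ B)

  -- An element of Winning a b P p is a winning strategy tree for Alice in the
  -- (a,b)-game from position p with player P to move. The tree is
  -- well-founded, so the empty moves that are legal on a full board
  -- cannot be used to avoid a loss.
  data Winning (a b : ℕ) : Player → Position → Set where
    won       : ∀ {P p} → AliceWon p → Winning a b P p
    aliceMove : ∀ {p} → ¬ BobWon p → ∀ S → LegalMove a p S →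
                Winning a b bob (colourRed S p) → Winning a b alice p
    bobMove   : ∀ {p} → ¬ BobWon p →
                (∀ S → LegalMove b p S → Winning a b alice (colourBlue S p)) →
                Winning a b bob p

  AliceWinsAliceStart AliceWinsBobStart : ℕ → ℕ → Set
  AliceWinsAliceStart a b = Winning a b alice start
  AliceWinsBobStart   a b = Winning a b bob   start

IsSmallestPositive : (ℕ → Set) → ℕ → Set
IsSmallestPositive P k = 1 ≤ k × P k × (∀ a → 1 ≤ a → P a → k ≤ a)

infix 4 a₁[_]≡_ a₁′[_]≡_

a₁[_]≡_ : Graph → ℕ → Set
a₁[ G ]≡ k = IsSmallestPositive (λ a → AliceWinsAliceStart G a 1) k

a₁′[_]≡_ : Graph → ℕ → Set
a₁′[ G ]≡ k = IsSmallestPositive (λ a → AliceWinsBobStart G a 1) k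

{-# OPTIONS --safe #-}

-- When every vertex v has at most a vertices other than v that together meet
-- all cliques through v, Alice wins by colouring them whenever Bob takes v: by
-- induction every clique with a blue vertex has a red one. For n ≥ 4 the
-- cliques are the edges and the four neighbours of v serve; for n = 3 they are
-- the triangles and, if m ≥ 4, the edges along C_m, and three vertices suffice.
--
-- Bob wins as soon as he makes more than a threats at once. For n ≥ 4 he plays
-- a vertex outside the closed neighbourhoods of Alice's at most three opening
-- vertices. For n = 3 he plays two vertices of one triangle whose surroundings
-- are red in at most one row.
--
-- The remaining wins of Alice, on C_3 □ C_3 with a = 1 and as first player on
-- C_3 □ C_4 with a = 2, are found by evaluating a greedy strategy.

module Submission where

open import Defs
open import Data.Bool using (Bool; not; _∨_)
open import Data.Bool.ListAction using (any)
open import Data.Fin as Fin using (Fin; zero; suc; fromℕ; fromℕ<; inject₁; toℕ; #_)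
open import Data.Fin.Properties using (toℕ-injective; toℕ<n; toℕ-fromℕ<; toℕ-fromℕ; toℕ-inject₁)
open import Data.Nat as ℕ
  using (ℕ; zero; suc; _+_; _*_; _∸_; _^_; _≤_; _<_; z≤n; s≤s; s≤s⁻¹)
open import Data.Nat.ListAction using (sum)
open import Data.Nat.Properties
  using ( ≤-refl; ≤-reflexive; ≤-trans; ≤-<-trans; <⇒≤; <⇒≱; <⇒≢; ≮⇒≥; m≤n⇒m<n∨m≡n
        ; suc-injective; +-suc; +-comm; +-assoc; +-identityʳ; +-cancelʳ-≡; +-mono-≤
        ; *-mono-≤; *-monoˡ-≤; m≤m+n; m≤n+m; m∸n+n≡m; ≤-totalOrder )
open import Data.List
  using ( List; []; _∷_; _++_; length; filter; filterᵇ; deduplicate; map; concatMap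
        ; allFin; cartesianProduct )
open import Data.List.Extrema ≤-totalOrder using (argmax)
open import Data.List.Membership.Propositional using (_∈_; _∉_; find; lose)
open import Data.List.Membership.Propositional.Properties
  using ( ∈-filter⁺; ∈-filter⁻; ∈-deduplicate⁺; ∈-deduplicate⁻; ∈-++⁺ˡ; ∈-++⁺ʳ; ∈-++⁻
        ; ∈-map⁺; ∈-map⁻; ∈-allFin; ∈-concatMap⁺ )
import Data.List.Membership.DecPropositional as DecMembership
open import Data.List.Properties
  using ( filter-notAll; length-filter; length-deduplicate; length-++; length-map
        ; length-tabulate; ++-identityʳ )
open import Data.List.Relation.Binary.Subset.Propositional using (_⊆_)
open import Data.List.Relation.Unary.All as All using (All; []; _∷_)
open import Data.List.Relation.Unary.All.Properties using (¬All⇒Any¬; map⁺)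
open import Data.List.Relation.Unary.AllPairs using ([]; _∷_)
open import Data.List.Relation.Unary.Any as Any using (Any; here; there; any?)
open import Data.List.Relation.Unary.Unique.Propositional using (Unique)
import Data.List.Relation.Unary.Unique.DecPropositional as DecUnique
import Data.List.Relation.Unary.Unique.DecPropositional.Properties as DecUniqueₚ
import Data.List.Relation.Unary.Unique.Propositional.Properties as Unique
open import Data.Maybe using (Maybe; just; nothing; _>>=_; to-witness-T)
open import Data.Product using (_×_; _,_; proj₁; proj₂; ∃-syntax)
open import Data.Product.Properties using (≡-dec)
open import Data.Sum using (_⊎_; inj₁; inj₂; [_,_]′)
open import Data.Unit using (tt)
open import Function using (_∘_)
open import Relation.Binary.Definitions using (DecidableEquality)
open import Relation.Binary.PropositionalEquality
  using (_≡_; _≢_; refl; sym; trans; cong; cong₂; subst; module ≡-Reasoning)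
open import Relation.Nullary using (¬_; Dec; yes; no; does; contradiction; ¬?; dec⇒maybe)
open import Relation.Nullary.Decidable using (_×-dec_; decidable-stable)

-- Counting in lists.

length-cartesianProduct : ∀ {A B : Set} (xs : List A) (ys : List B) →
                          length (cartesianProduct xs ys) ≡ length xs * length ys
length-cartesianProduct []       ys = refl
length-cartesianProduct (x ∷ xs) ys = trans (length-++ (map (x ,_) ys))
  (cong₂ _+_ (length-map (x ,_) ys) (length-cartesianProduct xs ys))

length-concatMap≤ : ∀ {A B : Set} {k} (f : A → List B) → (∀ x → length (f x) ≤ k) →
                    ∀ xs → length (concatMap f xs) ≤ length xs * k
length-concatMap≤ f f≤k []       = z≤n
length-concatMap≤ f f≤k (x ∷ xs) =
  ≤-trans (≤-reflexive (length-++ (f x))) (+-mono-≤ (f≤k x) (length-concatMap≤ f f≤k xs))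

module _ {A : Set} (_≟_ : DecidableEquality A) where

  open DecMembership _≟_ using (_∈?_)

  Unique-⊆⇒length≤ : {xs ys : List A} → Unique xs → xs ⊆ ys → length xs ≤ length ys
  Unique-⊆⇒length≤ [] _ = z≤n
  Unique-⊆⇒length≤ {x ∷ xs} {ys} (x∉xs ∷ uxs) sub =
    ≤-<-trans (Unique-⊆⇒length≤ uxs sub′)
              (filter-notAll x≢? ys (lose (sub (here refl)) (λ x≢x → x≢x refl)))
    where
    x≢? = λ y → ¬? (x ≟ y)
    sub′ : xs ⊆ filter x≢? ys
    sub′ z∈xs = ∈-filter⁺ x≢? (sub (there z∈xs)) (All.lookup x∉xs z∈xs)

  fresh : {xs ys : List A} → Unique xs → length ys < length xs →
          ∃[ x ] x ∈ xs × x ∉ ys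
  fresh {xs} {ys} uxs lt with All.all? (_∈? ys) xs
  ... | yes sub = contradiction (Unique-⊆⇒length≤ uxs (All.lookup sub)) (<⇒≱ lt)
  ... | no ¬sub = find (¬All⇒Any¬ (_∈? ys) xs ¬sub)

-- Threats, cliques and strategies on an arbitrary graph.

module _ {G : Graph} where

  open Graph G
  open Position

  LegalMove⇒length≤ : ∀ {k p S} → LegalMove G k p S → length S ≤ k
  LegalMove⇒length≤ (_ , _ , inj₁ e)        = ≤-reflexive e
  LegalMove⇒length≤ (_ , _ , inj₂ (lt , _)) = <⇒≤ lt

  singleMove : ∀ {p v} → Unplayed G p v → LegalMove G 1 p (v ∷ [])
  singleMove u = [] ∷ [] , u ∷ [] , inj₁ refl

  unhit : ∀ p {C} → IsClique G C → All (_∉ red p) C → ¬ AliceWon G p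
  unhit _ {C} clique C∩R=∅ w with find (w C clique)
  ... | _ , x∈C , x∈R = All.lookup C∩R=∅ x∈C x∈R

  -- A vertex is required: its singleton is what shows that the empty list is not maximal.
  cliqueNonempty : ∀ {C} → V → IsClique G C → ∃[ v ] v ∈ C
  cliqueNonempty {v ∷ _} _ _             = v , here refl
  cliqueNonempty {[]}    v (_ , maximal) =
    contradiction (maximal (v ∷ []) singleton (λ ()) (here refl)) λ ()
    where
    singleton : Complete G (v ∷ [])
    singleton (here refl) (here refl) v≢v = contradiction refl v≢v

  -- A `Position` does not force red and blue to be disjoint, so the absence of red in the clique is
  -- demanded separately.
  Threat : Position G → V → Set
  Threat p w = ∃[ C ] IsClique G C × C ⊆ w ∷ blue p × All (_∉ red p) C

  Unplayed-persists : ∀ {p S w} → w ∉ S → Unplayed G p w → Unplayed G (colourRed G S p) w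
  Unplayed-persists {S = S} w∉S (w∉R , w∉B) = [ w∉S , w∉R ]′ ∘ ∈-++⁻ S , w∉B

  -- All vertices of the threatened clique except possibly `w` are blue, so a legal move that misses
  -- `w` misses the clique.
  Threat-persists : ∀ {p S w} → All (Unplayed G p) S → w ∉ S →
                    Threat p w → Threat (colourRed G S p) w
  Threat-persists {position R B} {S} {w} free w∉S (C , clique , C⊆ , C∩R=∅) =
    C , clique , C⊆ , All.tabulate λ x∈C → [ ∉S (C⊆ x∈C) , All.lookup C∩R=∅ x∈C ]′ ∘ ∈-++⁻ S
    where
    ∉S : ∀ {x} → x ∈ w ∷ B → x ∉ S
    ∉S (here refl) = w∉S
    ∉S (there x∈B) x∈S = proj₂ (All.lookup free x∈S) x∈B

  bobPlays : ∀ {a p v} → ¬ AliceWon G p → Unplayed G p v →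
             ¬ Winning G a 1 alice (colourBlue G (v ∷ []) p) → ¬ Winning G a 1 bob p
  bobPlays ¬won _ _     (won w)       = ¬won w
  bobPlays _    u ¬wins (bobMove _ f) = ¬wins (f _ (singleMove u))

  -- Once `w` is blue, `aliceMove` is barred because the clique is blue, and `won` because it
  -- contains no red vertex.
  bobCompletes : ∀ {a p w} → Unplayed G p w → Threat p w → ¬ Winning G a 1 bob p
  bobCompletes {p = position R B} u (C , clique , C⊆ , C∩R=∅) =
    bobPlays (unhit (position R B) clique C∩R=∅) u λ
      { (won w)               → unhit (position R B) clique C∩R=∅ w
      ; (aliceMove ¬lost _ _ _) → ¬lost (C , clique , All.tabulate C⊆) }

  module _ (_≟_ : DecidableEquality V) where

    -- Alice colours at most `a` vertices, so one of the threats survives her move and Bob carries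
    -- it out.
    threatsWin : ∀ {a p} L → Unique L → a < length L →
                 All (λ w → Unplayed G p w × Threat p w) L → ¬ Winning G a 1 alice p
    threatsWin {p = position R B} L uL a<L threats (won w)
      with fresh _≟_ {ys = []} uL (≤-<-trans z≤n a<L)
    ... | _ , w∈L , _ with All.lookup threats w∈L
    ... | _ , _ , clique , _ , C∩R=∅ = unhit (position R B) clique C∩R=∅ w
    threatsWin L uL a<L threats (aliceMove _ S legal@(_ , free , _) W)
      with fresh _≟_ uL (≤-<-trans (LegalMove⇒length≤ legal) a<L)
    ... | w , w∈L , w∉S with All.lookup threats w∈L
    ... | u , t = bobCompletes (Unplayed-persists w∉S u) (Threat-persists free w∉S t) W

    edgeComplete : ∀ {u v} → Adj u v → Complete G (u ∷ v ∷ [])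
    edgeComplete uv (here refl)         (here refl)         u≢u = contradiction refl u≢u
    edgeComplete uv (here refl)         (there (here refl)) _   = uv
    edgeComplete uv (there (here refl)) (here refl)         _   = symm uv
    edgeComplete uv (there (here refl)) (there (here refl)) v≢v = contradiction refl v≢v

    edgeClique : ∀ {u v} → Adj u v → (∀ x → Adj u x → ¬ Adj v x) → IsClique G (u ∷ v ∷ [])
    edgeClique {u} {v} uv isolated = edgeComplete uv , maximal
      where
      maximal : ∀ D → Complete G D → u ∷ v ∷ [] ⊆ D → D ⊆ u ∷ v ∷ []
      maximal D cD sub {x} x∈D with x ≟ u | x ≟ v
      ... | yes refl | _        = here refl
      ... | no _     | yes refl = there (here refl)
      ... | no x≢u   | no x≢v   = contradiction
        (cD (sub (there (here refl))) x∈D (x≢v ∘ sym))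
        (isolated x (cD (sub (here refl)) x∈D (x≢u ∘ sym)))

    -- A clique whose only vertex is `v` would extend to the edge `v w`, against maximality.
    cliqueContainsNeighbour : ∀ {C v w} → Adj v w → IsClique G C → v ∈ C →
                              ∃[ x ] x ∈ C × Adj v x
    cliqueContainsNeighbour {C} {v} {w} vw (cC , maximal) v∈C
      with any? (λ x → ¬? (v ≟ x)) C
    ... | yes other with find other
    ...   | x , x∈C , v≢x = x , x∈C , cC v∈C x∈C v≢x
    cliqueContainsNeighbour {C} {v} {w} vw (cC , maximal) v∈C
        | no ¬other = w , maximal (v ∷ w ∷ []) (edgeComplete vw) C⊆ (there (here refl)) , vw
      where
      C⊆ : C ⊆ v ∷ w ∷ []
      C⊆ {x} x∈C with v ≟ x
      ... | yes refl = here refl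
      ... | no v≢x   = contradiction (lose x∈C v≢x) ¬other

    open DecMembership _≟_ using (_∈?_)

    unplayed? : ∀ p v → Dec (Unplayed G p v)
    unplayed? p v = ¬? (v ∈? red p) ×-dec ¬? (v ∈? blue p)

    -- A legal move has exactly `a` vertices unless the board runs out, so `S` is padded with
    -- unplayed vertices; `d` counts those still missing.
    extendToMove : ∀ {a p} d S → d + length S ≡ a → Unique S → All (Unplayed G p) S →
                   ∃[ S′ ] S ⊆ S′ × LegalMove G a p S′
    extendToMove zero S e uS free = S , (λ x∈S → x∈S) , uS , free , inj₁ e
    extendToMove {p = p} (suc d) S refl uS free
      with any? (λ v → unplayed? p v ×-dec ¬? (v ∈? S)) vertices
    ... | no ¬more = S , (λ x∈S → x∈S) , uS , free , inj₂ (s≤s (m≤n+m _ d) , covers)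
      where
      covers : ∀ v → Unplayed G p v → v ∈ S
      covers v u = decidable-stable (v ∈? S) λ v∉S → ¬more (lose (enumeration v) (u , v∉S))
    ... | yes more with find more
    ...   | v , _ , u , v∉S
      with extendToMove d (v ∷ S) (+-suc d (length S))
             (All.tabulate (λ { x∈S refl → v∉S x∈S }) ∷ uS) (u ∷ free)
    ...   | S′ , sub , legal = S′ , sub ∘ there , legal

    -- Played vertices and repetitions in `T` are dropped first, and the rest is padded to a legal
    -- move.
    moveCovering : ∀ {a} p T → length T ≤ a →
                   ∃[ S ] (∀ {x} → x ∈ T → Unplayed G p x → x ∈ S) × LegalMove G a p S
    moveCovering {a} p T T≤a =
      let S′ , sub , legal = extendToMove (a ∸ length S) S (m∸n+n≡m S≤a) (deduplicate-! T′) free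
      in S′ , (λ x∈T u → sub (∈-deduplicate⁺ _≟_ (∈-filter⁺ (unplayed? p) x∈T u))) , legal
      where
      open DecUniqueₚ _≟_ using (deduplicate-!)
      T′ = filter (unplayed? p) T
      S = deduplicate _≟_ T′
      S≤a : length S ≤ a
      S≤a = ≤-trans (length-deduplicate _≟_ T′) (≤-trans (length-filter (unplayed? p) T) T≤a)
      free : All (Unplayed G p) S
      free = All.tabulate λ x∈S →
        proj₂ (∈-filter⁻ (unplayed? p) {xs = T} (∈-deduplicate⁻ _≟_ T′ x∈S))

    Guarded : Position G → Set
    Guarded p = ∀ {C v} → IsClique G C → v ∈ C → v ∈ blue p → Any (_∈ red p) C

    module Responses
      {a} (response : V → List V) (response≤a : ∀ v → length (response v) ≤ a)
      (response-meets : ∀ {C v} → IsClique G C → v ∈ C →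
                        ∃[ w ] w ∈ C × w ∈ response v × w ≢ v)
      (v₀ : V)
      where

      -- Any vertex of a clique is now red or blue; if it is blue, the invariant supplies a red one.
      fullBoard : ∀ {p} → Guarded p → (∀ v → ¬ Unplayed G p v) → AliceWon G p
      fullBoard {p} guarded full C clique with cliqueNonempty v₀ clique
      ... | v , v∈C with v ∈? red p | v ∈? blue p
      ...   | yes v∈R | _       = lose v∈C v∈R
      ...   | no _    | yes v∈B = guarded clique v∈C v∈B
      ...   | no v∉R  | no v∉B  = contradiction (v∉R , v∉B) (full v)

      Disjoint : Position G → Set
      Disjoint p = ∀ {v} → v ∈ red p → v ∉ blue p

      notLost : ∀ {p} → Disjoint p → Guarded p → ¬ BobWon G p
      notLost disjoint guarded (C , clique , C⊆B) with cliqueNonempty v₀ clique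
      ... | v , v∈C with find (guarded clique v∈C (All.lookup C⊆B v∈C))
      ...   | _ , x∈C , x∈R = disjoint x∈R (All.lookup C⊆B x∈C)

      -- If the response to v meets a clique through v only in a blue vertex, then
      -- that clique was already guarded before v was played.
      guardedWinsFrom : ∀ k p U → length U ≤ k → (∀ {v} → Unplayed G p v → v ∈ U) →
                        Disjoint p → Guarded p → Winning G a 1 bob p
      guardedWinsFrom zero p [] _ ⊆U disjoint guarded =
        won (fullBoard guarded λ v u → contradiction (⊆U u) λ ())
      guardedWinsFrom (suc k) p U U≤k ⊆U disjoint guarded with any? (unplayed? p) vertices
      ... | no full = won (fullBoard guarded λ v u → full (lose (enumeration v) u))
      ... | yes free = bobMove (notLost disjoint guarded) reply
        where
        reply : ∀ S → LegalMove G 1 p S → Winning G a 1 alice (colourBlue G S p)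
        -- Bob may colour nothing only on a full board, which `free` excludes.
        reply [] (_ , _ , inj₂ (_ , full)) with find free
        ... | v , _ , u = contradiction (full v u) λ ()
        reply (_ ∷ _) (_ , _ , inj₂ (s≤s () , _))
        reply (v ∷ []) (_ , (v∉R , v∉B) ∷ [] , inj₁ refl)
          with moveCovering (colourBlue G (v ∷ []) p) (response v) (response≤a v)
        ... | S , covers , legal@(_ , S-free , _) =
          aliceMove (notLost {position (S ++ red p) (v ∷ blue p)} disjoint′ guarded′) S legal
            (guardedWinsFrom k _ (filter ≢v? U) U′≤k ⊆U′ disjoint′ guarded′)
          where
          ≢v? = λ x → ¬? (x ≟ v)
          -- Bob's vertex leaves `U`, which makes the induction on `k` go through.
          U′≤k : length (filter ≢v? U) ≤ k
          U′≤k = s≤s⁻¹ (≤-trans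
            (filter-notAll ≢v? U (lose (⊆U (v∉R , v∉B)) (λ v≢v → v≢v refl))) U≤k)
          ⊆U′ : ∀ {x} → Unplayed G (position (S ++ red p) (v ∷ blue p)) x → x ∈ filter ≢v? U
          ⊆U′ (x∉R , x∉B) =
            ∈-filter⁺ ≢v? (⊆U (x∉R ∘ ∈-++⁺ʳ S , x∉B ∘ there)) (x∉B ∘ here)
          disjoint′ : Disjoint (position (S ++ red p) (v ∷ blue p))
          disjoint′ x∈R x∈B with ∈-++⁻ S x∈R
          disjoint′ _ x∈B         | inj₁ x∈S = proj₂ (All.lookup S-free x∈S) x∈B
          disjoint′ _ (here refl) | inj₂ x∈R = v∉R x∈R
          disjoint′ _ (there x∈B) | inj₂ x∈R = disjoint x∈R x∈B
          guarded′ : Guarded (position (S ++ red p) (v ∷ blue p))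
          guarded′ clique x∈C (there x∈B) = Any.map (∈-++⁺ʳ S) (guarded clique x∈C x∈B)
          guarded′ clique x∈C (here refl) with response-meets clique x∈C
          ... | w , w∈C , w∈resp , w≢v with w ∈? red p | w ∈? blue p
          ...   | yes w∈R | _       = lose w∈C (∈-++⁺ʳ S w∈R)
          ...   | no _    | yes w∈B = Any.map (∈-++⁺ʳ S) (guarded clique w∈C w∈B)
          ...   | no w∉R  | no w∉B  = lose w∈C (∈-++⁺ˡ
            (covers w∈resp (w∉R , λ { (here w≡v) → w≢v w≡v ; (there w∈B) → w∉B w∈B })))

      aliceWinsSecond : AliceWinsBobStart G a 1
      aliceWinsSecond =
        guardedWinsFrom _ _ vertices ≤-refl (λ {v} _ → enumeration v) (λ ()) (λ _ _ ())

      -- Any opening will do: without blue vertices `Guarded` is vacuous, whatever is red.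
      aliceWinsFirst : AliceWinsAliceStart G a 1
      aliceWinsFirst with moveCovering (start G) [] z≤n
      ... | S , _ , legal = aliceMove (notLost {start G} (λ ()) (λ _ _ ())) S legal
        (guardedWinsFrom _ _ vertices ≤-refl (λ {v} _ → enumeration v) (λ _ ()) (λ _ _ ()))

-- Search for winning trees by evaluation.

module Search
  {G : Graph} (_≟_ : DecidableEquality (Graph.V G)) (lines : List (List (Graph.V G)))
  (clique⊇line : ∀ {C} → IsClique G C → ∃[ L ] L ∈ lines × L ⊆ C)
  (a : ℕ)
  where

  open Graph G
  open Position
  open DecMembership _≟_ using (_∈?_)
  open DecUnique _≟_ using (unique?)

  -- Decidable substitutes for `AliceWon` and `BobWon`, which quantify over all cliques. As every
  -- clique contains a line, `AllHit` implies `AliceWon` and `BobWon` implies `SomeBlue`, the two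
  -- directions that a tree for Alice uses.
  AllHit SomeBlue : Position G → Set
  AllHit   p = All (Any (_∈ red p)) lines
  SomeBlue p = Any (All (_∈ blue p)) lines

  allHit? : ∀ p → Dec (AllHit p)
  allHit? p = All.all? (any? (_∈? red p)) lines

  someBlue? : ∀ p → Dec (SomeBlue p)
  someBlue? p = any? (All.all? (_∈? blue p)) lines

  AllHit⇒AliceWon : ∀ p → AllHit p → AliceWon G p
  AllHit⇒AliceWon p hit C clique with clique⊇line clique
  ... | L , L∈ , L⊆C with find (All.lookup hit L∈)
  ... | _ , x∈L , x∈R = lose (L⊆C x∈L) x∈R

  BobWon⇒SomeBlue : ∀ p → BobWon G p → SomeBlue p
  BobWon⇒SomeBlue p (C , clique , C⊆B) with clique⊇line clique
  ... | L , L∈ , L⊆C = lose L∈ (All.tabulate (All.lookup C⊆B ∘ L⊆C))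

  private
    _∈ᵇ_ : V → List V → Bool
    v ∈ᵇ xs = any (λ x → does (v ≟ x)) xs

    -- An Erdős–Selfridge potential for lines of at most three vertices: a line
    -- without red gains a factor 3 per blue vertex. With base 2 the greedy
    -- strategy loses on C_3 □ C_4.
    live : Position G → List (ℕ × List V)
    live p = map (λ L → 3 ^ (length (filterᵇ (_∈ᵇ blue p) L) + (3 ∸ length L)) , L)
      (filterᵇ (λ L → not (any (_∈ᵇ red p) L)) lines)

    weight : List (ℕ × List V) → V → ℕ
    weight wLs v = sum (map proj₁ (filterᵇ (λ wL → v ∈ᵇ proj₂ wL) wLs))

    heaviest : List (ℕ × List V) → List V → List V
    heaviest _   []       = []
    heaviest wLs (v ∷ vs) = argmax (weight wLs) v vs ∷ []

  greedy : ℕ → Position G → List V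
  greedy zero    p = []
  -- The with-abstraction shares the evaluation of S between its two uses.
  greedy (suc k) p
    with heaviest (live p) (filterᵇ (λ v → not (v ∈ᵇ red p ∨ v ∈ᵇ blue p)) vertices)
  ... | S = greedy k (colourRed G S p) ++ S

  -- Only moves of full size are accepted, so in a tree that is found Alice never moves with fewer
  -- than `a` vertices left.
  legal? : ∀ p S → Maybe (LegalMove G a p S)
  legal? p S = do
    u ← dec⇒maybe (unique? S)
    f ← dec⇒maybe (All.all? (unplayed? _≟_ p) S)
    l ← dec⇒maybe (length S ℕ.≟ a)
    just (u , f , inj₁ l)

  forAll : {P : V → Set} → (∀ v → Maybe (P v)) → ∀ vs → Maybe (All P vs)
  forAll f []       = just []
  forAll f (v ∷ vs) = do
    p  ← f v
    ps ← forAll f vs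
    just (p ∷ ps)

  -- The number bounds Alice's remaining moves. Her next move is an argument so that an opening can
  -- be prescribed; after that she plays `greedy`, while all replies of Bob are tried.
  searchAlice : ℕ → List V → ∀ p → Maybe (Winning G a 1 alice p)
  searchBob   : ℕ → ∀ p → Maybe (Winning G a 1 bob p)

  searchAlice zero _ p = nothing
  searchAlice (suc k) S p with someBlue? p
  ... | yes _ = nothing
  ... | no ¬lost = do
    l ← legal? p S
    w ← searchBob k (colourRed G S p)
    just (aliceMove (¬lost ∘ BobWon⇒SomeBlue p) S l w)

  searchBob k p with allHit? p | someBlue? p | any? (unplayed? _≟_ p) vertices
  ... | yes hit | _        | _        = just (won (AllHit⇒AliceWon p hit))
  ... | no _    | no ¬lost | yes free = do
    replies ← forAll reply vertices
    just (bobMove (¬lost ∘ BobWon⇒SomeBlue p) λ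
      { [] (_ , _ , inj₂ (_ , full)) → contradiction (full _ (proj₂ (proj₂ (find free)))) λ ()
      ; (_ ∷ _) (_ , _ , inj₂ (s≤s () , _))
      ; (v ∷ []) (_ , u ∷ [] , inj₁ refl) → All.lookup replies (enumeration v) u })
    where
    reply : ∀ v → Maybe (Unplayed G p v → Winning G a 1 alice (colourBlue G (v ∷ []) p))
    reply v with unplayed? _≟_ p v
    ... | no ¬u = just λ u → contradiction u ¬u
    ... | yes _ = do
      w ← searchAlice k (greedy a (colourBlue G (v ∷ []) p)) (colourBlue G (v ∷ []) p)
      just λ _ → w
  ... | no _    | _        | _        = nothing

-- Cyclic successors and closed walks.

TriangleFree : Graph → Set
TriangleFree G = ∀ {u v w} → Adj u v → Adj v w → ¬ Adj u w
  where open Graph G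

module _ {n : ℕ} where

  succ pred : Fin n → Fin n
  Next-succ : ∀ i → Next i (succ i)
  Next-pred : ∀ i → Next (pred i) i

  private
    next : (i : Fin n) → ∃[ j ] Next i j
    next i with m≤n⇒m<n∨m≡n (toℕ<n i)
    next i       | inj₁ lt = fromℕ< lt , inj₁ (sym (toℕ-fromℕ< lt))
    -- Splitting on `i` exposes `n` as a successor, so that `zero` has type `Fin n`.
    next zero    | inj₂ e  = zero , inj₂ (e , refl)
    next (suc i) | inj₂ e  = zero , inj₂ (e , refl)

    previous : ∀ {n} (i : Fin n) → ∃[ j ] Next j i
    previous zero    = fromℕ _ , inj₂ (cong suc (toℕ-fromℕ _) , refl)
    previous (suc i) = inject₁ i , inj₁ (cong suc (toℕ-inject₁ i))

  succ = proj₁ ∘ next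
  pred = proj₁ ∘ previous
  Next-succ = proj₂ ∘ next
  Next-pred = proj₂ ∘ previous

  Next-functional : ∀ {i j k : Fin n} → Next i j → Next i k → j ≡ k
  Next-functional (inj₁ e)       (inj₁ e′)       = toℕ-injective (trans (sym e) e′)
  Next-functional {j = j} (inj₁ e) (inj₂ (e′ , _)) = contradiction (trans (sym e) e′) (<⇒≢ (toℕ<n j))
  Next-functional {k = k} (inj₂ (e , _)) (inj₁ e′) = contradiction (trans (sym e′) e) (<⇒≢ (toℕ<n k))
  Next-functional (inj₂ (_ , z)) (inj₂ (_ , z′)) = toℕ-injective (trans z (sym z′))

  Next-injective : ∀ {i j k : Fin n} → Next i k → Next j k → i ≡ j
  Next-injective (inj₁ e)       (inj₁ e′)       = toℕ-injective (suc-injective (trans e (sym e′)))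
  Next-injective (inj₁ e)       (inj₂ (_ , z))  = contradiction (trans e z) λ ()
  Next-injective (inj₂ (_ , z)) (inj₁ e)        = contradiction (trans e z) λ ()
  Next-injective (inj₂ (e , _)) (inj₂ (e′ , _)) = toℕ-injective (suc-injective (trans e (sym e′)))

  data Walk : ℕ → Fin n → Fin n → Set where
    []  : ∀ {i} → Walk 0 i i
    _∷_ : ∀ {l i j k} → Next i j → Walk l j k → Walk (suc l) i k

  -- The witness `t` counts how often the walk wraps around from the last index to zero.
  Walk⇒+ : ∀ {l i j} → Walk l i j → ∃[ t ] l + toℕ i ≡ toℕ j + t * n
  Walk⇒+ {i = i} [] = 0 , sym (+-identityʳ (toℕ i))
  Walk⇒+ {suc l} {i} (inj₁ e ∷ w) with Walk⇒+ w
  ... | t , eq = t , trans (trans (sym (+-suc l (toℕ i))) (cong (l +_) e)) eq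
  Walk⇒+ {suc l} {i} {k} (_∷_ {j = j} (inj₂ (e , z)) w) with Walk⇒+ w
  ... | t , eq = suc t , (begin
    suc l + toℕ i          ≡⟨ +-suc l (toℕ i) ⟨
    l + suc (toℕ i)        ≡⟨ cong (l +_) e ⟩
    l + n                  ≡⟨ cong (_+ n) (sym (+-identityʳ l)) ⟩
    l + 0 + n              ≡⟨ cong (λ x → l + x + n) z ⟨
    l + toℕ j + n          ≡⟨ cong (_+ n) eq ⟩
    toℕ k + t * n + n      ≡⟨ +-assoc (toℕ k) (t * n) n ⟩
    toℕ k + (t * n + n)    ≡⟨ cong (toℕ k +_) (+-comm (t * n) n) ⟩
    toℕ k + suc t * n      ∎)
    where open ≡-Reasoning

  -- The length of a closed walk is a multiple of `n`, and a positive one is at least `n`.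
  noShortClosedWalk : ∀ {l i} → Walk (suc l) i i → ¬ suc l < n
  noShortClosedWalk {l} {i} w l<n with Walk⇒+ w
  ... | t , eq with +-cancelʳ-≡ (toℕ i) (suc l) (t * n) (trans eq (+-comm (toℕ i) (t * n)))
  noShortClosedWalk _ l<n | suc t , _ | e =
    <⇒≱ l<n (≤-trans (m≤m+n n (t * n)) (≤-reflexive (sym e)))

-- Neighbours and triangles in a cycle.

module Cycle {n : ℕ} (3≤n : 3 ≤ n) where

  open Graph (cycle n 3≤n) public using (Adj)

  Adj-irrefl : ∀ {i} → ¬ Adj i i
  Adj-irrefl = Graph.irrefl (cycle n 3≤n) refl

  Adj-succ : ∀ i → Adj i (succ i)
  Adj-succ i = inj₁ (Next-succ i)

  Adj-pred : ∀ i → Adj i (pred i)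
  Adj-pred i = inj₂ (Next-pred i)

  succ-pred : (i : Fin n) → succ (pred i) ≡ i
  succ-pred i = Next-functional {i = pred i} (Next-succ (pred i)) (Next-pred i)

  pred-succ : (i : Fin n) → pred (succ i) ≡ i
  pred-succ i = Next-injective {k = succ i} (Next-pred (succ i)) (Next-succ i)

  Adj⇒succ⊎pred : ∀ {i j} → Adj i j → j ≡ succ i ⊎ j ≡ pred i
  Adj⇒succ⊎pred {i} (inj₁ ij) = inj₁ (Next-functional {i = i} ij (Next-succ i))
  Adj⇒succ⊎pred {i} (inj₂ ji) = inj₂ (Next-injective {k = i} ji (Next-pred i))

  succ≢ : ∀ i → succ i ≢ i
  succ≢ i e = Adj-irrefl (subst (Adj i) e (Adj-succ i))

  pred≢ : ∀ i → pred i ≢ i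
  pred≢ i e = Adj-irrefl (subst (Adj i) e (Adj-pred i))

  succ≢pred : ∀ i → succ i ≢ pred i
  succ≢pred i e =
    noShortClosedWalk (Next-succ i ∷ subst (λ j → Next j i) (sym e) (Next-pred i) ∷ []) 3≤n

  -- A cyclically oriented triangle is a closed walk of length three. Otherwise two of its edges
  -- leave, or two enter, the same vertex, and their other ends coincide.
  triangleFree : 4 ≤ n → TriangleFree (cycle n 3≤n)
  triangleFree 4≤n (inj₁ ij) (inj₁ jk) (inj₂ ki) = noShortClosedWalk (ij ∷ jk ∷ ki ∷ []) 4≤n
  triangleFree 4≤n (inj₂ ji) (inj₂ kj) (inj₁ ik) = noShortClosedWalk (ik ∷ kj ∷ ji ∷ []) 4≤n
  triangleFree _ (inj₁ ij) jk (inj₁ ik) = Adj-irrefl (subst (Adj _) (Next-functional ik ij) jk)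
  triangleFree _ (inj₂ ji) jk (inj₂ ki) = Adj-irrefl (subst (Adj _) (Next-injective ki ji) jk)
  triangleFree _ (inj₁ ij) (inj₂ kj) ik = Adj-irrefl (subst (Adj _) (Next-injective kj ij) ik)
  triangleFree _ (inj₂ ji) (inj₁ jk) ik = Adj-irrefl (subst (Adj _) (Next-functional jk ji) ik)

cycle₃-complete : (3≤3 : 3 ≤ 3) {i j : Fin 3} → i ≢ j → Graph.Adj (cycle 3 3≤3) i j
cycle₃-complete _ {zero}          {zero}          i≢i = contradiction refl i≢i
cycle₃-complete _ {zero}          {suc zero}       _  = inj₁ (inj₁ refl)
cycle₃-complete _ {zero}          {suc (suc zero)} _  = inj₂ (inj₂ (refl , refl))
cycle₃-complete _ {suc zero}      {zero}           _  = inj₂ (inj₁ refl)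
cycle₃-complete _ {suc zero}      {suc zero}      i≢i = contradiction refl i≢i
cycle₃-complete _ {suc zero}      {suc (suc zero)} _  = inj₁ (inj₁ refl)
cycle₃-complete _ {suc (suc zero)} {zero}          _  = inj₁ (inj₂ (refl , refl))
cycle₃-complete _ {suc (suc zero)} {suc zero}      _  = inj₂ (inj₁ refl)
cycle₃-complete _ {suc (suc zero)} {suc (suc zero)} i≢i = contradiction refl i≢i

-- Edges of a product that are cliques.

module _ {G H : Graph} where

  private
    module G = Graph G
    module H = Graph H
  open Graph (G □ H) using (V; Adj)

  -- A common neighbour must also have first coordinate `g`, and then it gives a triangle in `H`.
  horizontalIsolated : TriangleFree H → ∀ {g h h′} → H.Adj h h′ →
                       ∀ x → Adj (g , h) x → ¬ Adj (g , h′) x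
  horizontalIsolated tf hh′ _ (inj₁ (gx , refl)) (inj₁ (_ , refl))  = H.irrefl refl hh′
  horizontalIsolated tf hh′ _ (inj₁ (gx , _))    (inj₂ (refl , _))  = G.irrefl refl gx
  horizontalIsolated tf hh′ _ (inj₂ (refl , _))  (inj₁ (gx , _))    = G.irrefl refl gx
  horizontalIsolated tf hh′ _ (inj₂ (_ , hx))    (inj₂ (_ , h′x))   = tf hh′ h′x hx

  verticalIsolated : TriangleFree G → ∀ {g g′ h} → G.Adj g g′ →
                     ∀ x → Adj (g , h) x → ¬ Adj (g′ , h) x
  verticalIsolated tf gg′ _ (inj₂ (refl , _)) (inj₂ (refl , _)) = G.irrefl refl gg′
  verticalIsolated tf gg′ _ (inj₂ (_ , hx))   (inj₁ (_ , refl)) = H.irrefl refl hx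
  verticalIsolated tf gg′ _ (inj₁ (_ , refl)) (inj₂ (_ , hx))   = H.irrefl refl hx
  verticalIsolated tf gg′ _ (inj₁ (gx , _))   (inj₁ (g′x , _))  = tf gg′ g′x gx

  module _ (_≟_ : DecidableEquality V) where

    horizontalClique : TriangleFree H → ∀ g {h h′} → H.Adj h h′ →
                       IsClique (G □ H) ((g , h) ∷ (g , h′) ∷ [])
    horizontalClique tf g hh′ =
      edgeClique {G □ H} _≟_ (inj₂ (refl , hh′)) (horizontalIsolated tf hh′)

    □-edgeClique : TriangleFree G → TriangleFree H → ∀ {u v} → Adj u v →
                   IsClique (G □ H) (u ∷ v ∷ [])
    □-edgeClique tfG tfH uv@(inj₁ (gg′ , refl)) = edgeClique {G □ H} _≟_ uv (verticalIsolated tfG gg′)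
    □-edgeClique tfG tfH uv@(inj₂ (refl , hh′)) = edgeClique {G □ H} _≟_ uv (horizontalIsolated tfH hh′)

_≟×_ : ∀ {n m} → DecidableEquality (Fin n × Fin m)
_≟×_ = ≡-dec Fin._≟_ Fin._≟_

-- The case of both cycles of length at least four.

module Torus {n m} (3≤n : 3 ≤ n) (3≤m : 3 ≤ m) (4≤n : 4 ≤ n) (4≤m : 4 ≤ m) where

  private
    module Cₙ = Cycle 3≤n
    module Cₘ = Cycle 3≤m
  G = cycle n 3≤n □ cycle m 3≤m
  open Graph G

  neighbours : V → List V
  neighbours (i , j) = (succ i , j) ∷ (pred i , j) ∷ (i , succ j) ∷ (i , pred j) ∷ []

  Adj⇒∈neighbours : ∀ {u v} → Adj u v → v ∈ neighbours u
  Adj⇒∈neighbours (inj₁ (ii′ , refl)) with Cₙ.Adj⇒succ⊎pred ii′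
  ... | inj₁ refl = here refl
  ... | inj₂ refl = there (here refl)
  Adj⇒∈neighbours (inj₂ (refl , jj′)) with Cₘ.Adj⇒succ⊎pred jj′
  ... | inj₁ refl = there (there (here refl))
  ... | inj₂ refl = there (there (there (here refl)))

  ∈neighbours⇒Adj : ∀ {u v} → v ∈ neighbours u → Adj u v
  ∈neighbours⇒Adj {i , j} (here refl)                         = inj₁ (Cₙ.Adj-succ i , refl)
  ∈neighbours⇒Adj {i , j} (there (here refl))                 = inj₁ (Cₙ.Adj-pred i , refl)
  ∈neighbours⇒Adj {i , j} (there (there (here refl)))         = inj₂ (refl , Cₘ.Adj-succ j)
  ∈neighbours⇒Adj {i , j} (there (there (there (here refl)))) = inj₂ (refl , Cₘ.Adj-pred j)

  neighbours-unique : ∀ v → Unique (neighbours v)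
  neighbours-unique (i , j) =
    (Cₙ.succ≢pred i ∘ cong proj₁ ∷ Cₙ.succ≢ i ∘ cong proj₁ ∷ Cₙ.succ≢ i ∘ cong proj₁ ∷ []) ∷
    (Cₙ.pred≢ i ∘ cong proj₁ ∷ Cₙ.pred≢ i ∘ cong proj₁ ∷ []) ∷
    (Cₘ.succ≢pred j ∘ cong proj₂ ∷ []) ∷ [] ∷ []

  edge-IsClique : ∀ {u v} → Adj u v → IsClique G (u ∷ v ∷ [])
  edge-IsClique = □-edgeClique {cycle n 3≤n} {cycle m 3≤m} _≟×_
    (Cₙ.triangleFree 4≤n) (Cₘ.triangleFree 4≤m)

  -- Bob plays `v`; each of its four neighbours then threatens to complete an edge, and Alice can
  -- stop only three.
  bobWinsAt : ∀ {a R} v → a ≤ 3 → v ∉ R → All (_∉ R) (neighbours v) →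
              ¬ Winning G a 1 bob (position R [])
  bobWinsAt {R = R} v@(i , j) a≤3 v∉R N∩R=∅@(s∉R ∷ _) =
    bobPlays {G}
      (unhit {G} (position R []) (edge-IsClique (∈neighbours⇒Adj {v} (here refl))) (v∉R ∷ s∉R ∷ []))
      (v∉R , λ ())
      (threatsWin {G} _≟×_ (neighbours v) (neighbours-unique v) (s≤s a≤3) (All.tabulate threat))
    where
    threat : ∀ {w} → w ∈ neighbours v →
             Unplayed G (position R (v ∷ [])) w × Threat {G} (position R (v ∷ [])) w
    threat {w} w∈N =
      (w∉R , λ { (here refl) → irrefl {v} refl vw }) ,
      v ∷ w ∷ [] , edge-IsClique vw , (λ { (here e) → there (here e) ; (there (here e)) → here e }) ,
      v∉R ∷ w∉R ∷ []
      where
      vw = ∈neighbours⇒Adj w∈N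
      w∉R = All.lookup N∩R=∅ w∈N

  -- Three closed neighbourhoods cover at most 15 of the at least 16 vertices.
  undominated : ∀ S → length S ≤ 3 → ∃[ v ] v ∉ S × All (_∉ S) (neighbours v)
  undominated S S≤3 with fresh _≟×_ vertices-unique (≤-trans (s≤s covered≤15) 16≤nm)
    where
    closed : V → List V
    closed x = x ∷ neighbours x
    covered≤15 : length (concatMap closed S) ≤ 15
    covered≤15 = ≤-trans (length-concatMap≤ closed (λ _ → ≤-refl) S) (*-monoˡ-≤ 5 S≤3)
    vertices-unique : Unique vertices
    vertices-unique = Unique.cartesianProduct⁺ (Unique.allFin⁺ n) (Unique.allFin⁺ m)
    16≤nm : 16 ≤ length vertices
    16≤nm = ≤-trans (*-mono-≤ 4≤n 4≤m) (≤-reflexive (sym (trans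
      (length-cartesianProduct (allFin n) (allFin m))
      (cong₂ _*_ (length-tabulate {n = n} _) (length-tabulate {n = m} _)))))
  ... | v , _ , v∉ = v , (λ v∈S → v∉ (covers v∈S (here refl))) ,
    -- By symmetry, a neighbour of `v` in `S` would have `v` in its own closed neighbourhood.
    All.tabulate λ w∈N w∈S → v∉ (covers w∈S (there (Adj⇒∈neighbours (symm (∈neighbours⇒Adj w∈N)))))
    where
    covers : ∀ {x y} → x ∈ S → y ∈ x ∷ neighbours x → y ∈ concatMap (λ x → x ∷ neighbours x) S
    covers x∈S y∈ = ∈-concatMap⁺ (λ x → x ∷ neighbours x) (lose x∈S y∈)

  bobWinsSecond : ∀ {a} → V → a ≤ 3 → ¬ AliceWinsAliceStart G a 1
  bobWinsSecond v a≤3 (won w) =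
    unhit {G} (start G) (edge-IsClique {v} (∈neighbours⇒Adj (here refl))) (All.tabulate (λ _ ())) w
  bobWinsSecond _ a≤3 (aliceMove _ S legal W)
    with undominated S (≤-trans (LegalMove⇒length≤ {G} legal) a≤3)
  ... | v , v∉S , N∩S=∅ = bobWinsAt v a≤3
    (subst (v ∉_) (sym (++-identityʳ S)) v∉S)
    (subst (λ R → All (_∉ R) (neighbours v)) (sym (++-identityʳ S)) N∩S=∅) W

  bobWinsFirst : ∀ {a} → V → a ≤ 3 → ¬ AliceWinsBobStart G a 1
  bobWinsFirst v a≤3 = bobWinsAt v a≤3 (λ ()) (All.tabulate (λ _ ()))

  response-meets : ∀ {C v} → IsClique G C → v ∈ C → ∃[ w ] w ∈ C × w ∈ neighbours v × w ≢ v
  response-meets {v = i , j} clique v∈C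
    with cliqueContainsNeighbour {G} _≟×_ (inj₁ (Cₙ.Adj-succ i , refl)) clique v∈C
  ... | w , w∈C , vw = w , w∈C , Adj⇒∈neighbours vw , λ { refl → irrefl {w} refl vw }

  open Responses {G} _≟×_ neighbours (λ _ → ≤-refl) response-meets public


-- Products of a triangle with a cycle.

module Prism {m} (3≤3 : 3 ≤ 3) (3≤m : 3 ≤ m) where

  private
    module C₃ = Cycle 3≤3
    module Cₘ = Cycle 3≤m
  G = cycle 3 3≤3 □ cycle m 3≤m
  open Graph G

  column : Fin m → List V
  column j = map (_, j) (allFin 3)

  ∈column : ∀ g j → (g , j) ∈ column j
  ∈column g j = ∈-map⁺ (_, j) (∈-allFin g)

  allColumn : ∀ {P : V → Set} {j} → (∀ g → P (g , j)) → All P (column j)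
  allColumn Pgj = map⁺ (All.universal Pgj (allFin 3))

  column-complete : ∀ j → Complete G (column j)
  column-complete j u∈ v∈ u≢v with ∈-map⁻ (_, j) u∈ | ∈-map⁻ (_, j) v∈
  ... | g , _ , refl | h , _ , refl = inj₁ (cycle₃-complete 3≤3 (u≢v ∘ cong (_, j)) , refl)

  -- A vertex outside the column is adjacent to at most the vertex of the column in its own row, so
  -- not to the one in row `succ g`.
  column-IsClique : ∀ j → IsClique G (column j)
  column-IsClique j = column-complete j , maximal
    where
    maximal : ∀ D → Complete G D → column j ⊆ D → D ⊆ column j
    maximal D cD sub {g , h} x∈D with h Fin.≟ j
    ... | yes refl = ∈column g j
    ... | no h≢j with cD (sub (∈column (succ g) j)) x∈D (h≢j ∘ sym ∘ cong proj₂)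
    ...   | inj₁ (_ , j≡h)   = contradiction (sym j≡h) h≢j
    ...   | inj₂ (sg≡g , _) = contradiction sg≡g (C₃.succ≢ g)

  -- A vertex of `C` outside column `j` is adjacent to `(i , j)`, hence in row `i`. If there is
  -- none, `C` lies in the column and equals it by maximality.
  splitClique : ∀ {C i j} → IsClique G C → (i , j) ∈ C →
                (∃[ h ] Cₘ.Adj j h × (i , h) ∈ C) ⊎ column j ⊆ C
  splitClique {C} {i} {j} (cC , maximal) ij∈C with any? (λ x → ¬? (proj₂ x Fin.≟ j)) C
  ... | no ¬other = inj₂ (maximal (column j) (column-complete j) C⊆)
    where
    C⊆ : C ⊆ column j
    C⊆ {g , h} x∈C with h Fin.≟ j
    ... | yes refl = ∈column g j
    ... | no h≢j   = contradiction (lose x∈C h≢j) ¬other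
  ... | yes other with find other
  ...   | (g , h) , x∈C , h≢j with cC ij∈C x∈C (h≢j ∘ sym ∘ cong proj₂)
  ...     | inj₁ (_ , j≡h)   = contradiction (sym j≡h) h≢j
  ...     | inj₂ (refl , jh) = inj₁ (h , jh , x∈C)

  response : V → List V
  response (i , j) = (succ i , j) ∷ (i , succ j) ∷ (i , pred j) ∷ []

  response-meets : ∀ {C v} → IsClique G C → v ∈ C → ∃[ w ] w ∈ C × w ∈ response v × w ≢ v
  response-meets {v = i , j} clique v∈C with splitClique clique v∈C
  ... | inj₂ col⊆C = _ , col⊆C (∈column (succ i) j) , here refl , C₃.succ≢ i ∘ cong proj₁
  ... | inj₁ (h , jh , ih∈C) with Cₘ.Adj⇒succ⊎pred jh
  ...   | inj₁ refl = _ , ih∈C , there (here refl) , Cₘ.succ≢ j ∘ cong proj₂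
  ...   | inj₂ refl = _ , ih∈C , there (there (here refl)) , Cₘ.pred≢ j ∘ cong proj₂

  open Responses {G} _≟×_ response (λ _ → ≤-refl) response-meets public

  module _ (4≤m : 4 ≤ m) where

    edge-IsClique : ∀ g {j h} → Cₘ.Adj j h → IsClique G ((g , j) ∷ (g , h) ∷ [])
    edge-IsClique = horizontalClique {cycle 3 3≤3} {cycle m 3≤m} _≟×_ (Cₘ.triangleFree 4≤m)

    -- Describes red vertices harmless to Bob's fork in column `j`: he uses the horizontal edges of
    -- the two rows other than `r`.
    Clear : Fin 3 → Fin m → V → Set
    Clear r j (g , h) = h ≢ j × (g ≡ r ⊎ h ≢ succ j × h ≢ pred j)

    -- Bob colours (succ r , j), forcing Alice to answer at its two horizontal
    -- neighbours, and then (pred r , j), which makes three threats.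
    bobForks : ∀ {a R} r j → a ≤ 2 → All (Clear r j) R → ¬ Winning G a 1 bob (position R [])
    bobForks {a} {R} r j a≤2 clear =
      bobPlays {G} (unhit {G} (position R []) (column-IsClique j) column∉R) (∉R (succ r) , λ ()) λ
        { (won w) → unhit {G} (position R []) (column-IsClique j) column∉R w
        ; (aliceMove _ S legal W) → afterAnswer S legal W }
      where
      open DecMembership (_≟×_ {3} {m}) using (_∈?_)

      ∉R : ∀ g → (g , j) ∉ R
      ∉R g x∈R = proj₁ (All.lookup clear x∈R) refl

      column∉R : All (_∉ R) (column j)
      column∉R = allColumn ∉R

      side∉R : ∀ {g h} → g ≢ r → h ≡ succ j ⊎ h ≡ pred j → (g , h) ∉ R
      side∉R g≢r side x∈R with All.lookup clear x∈R | side
      ... | _ , inj₁ g≡r       | _      = g≢r g≡r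
      ... | _ , inj₂ (h≢s , _) | inj₁ e = h≢s e
      ... | _ , inj₂ (_ , h≢p) | inj₂ e = h≢p e

      v₁ v₂ : V
      v₁ = succ r , j
      v₂ = pred r , j
      p₁ : Position G
      p₁ = position R (v₁ ∷ [])

      sideThreat : ∀ {g h B} R′ → Cₘ.Adj j h → (g , j) ∈ B → (g , j) ∉ R′ → (g , h) ∉ R′ →
                   Threat {G} (position R′ B) (g , h)
      sideThreat {g} _ jh gj∈B gj∉ gh∉ =
        _ , edge-IsClique g jh ,
        (λ { (here refl) → there gj∈B ; (there (here e)) → here e }) , gj∉ ∷ gh∉ ∷ []

      afterAnswer : ∀ S → LegalMove G a p₁ S →
                    ¬ Winning G a 1 bob (colourRed G S p₁)
      afterAnswer S legal@(_ , S-free , _) W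
        with (succ r , succ j) ∈? S | (succ r , pred j) ∈? S
      -- If Alice leaves either horizontal neighbour of `v₁` open, Bob completes that edge.
      ... | no s∉S | _ = bobCompletes {G}
        (Unplayed-persists {G} s∉S (side∉R (C₃.succ≢ r) (inj₁ refl) ,
          λ { (here e) → Cₘ.succ≢ j (cong proj₂ e) }))
        (Threat-persists {G} S-free s∉S
          (sideThreat R (Cₘ.Adj-succ j) (here refl) (∉R _) (side∉R (C₃.succ≢ r) (inj₁ refl)))) W
      ... | _ | no p∉S = bobCompletes {G}
        (Unplayed-persists {G} p∉S (side∉R (C₃.succ≢ r) (inj₂ refl) ,
          λ { (here e) → Cₘ.pred≢ j (cong proj₂ e) }))
        (Threat-persists {G} S-free p∉S
          (sideThreat R (Cₘ.Adj-pred j) (here refl) (∉R _) (side∉R (C₃.succ≢ r) (inj₂ refl)))) W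
      ... | yes s∈S | yes p∈S =
        bobPlays {G} (unhit {G} p₂ (column-IsClique j) column∉)
          (∉S++R (pred r) , λ { (here e) → C₃.succ≢pred r (sym (cong proj₁ e)) })
          (threatsWin {G} _≟×_ threats unique (s≤s a≤2)
            ( ((side∉ (inj₁ refl) ,
                λ { (here e)         → Cₘ.succ≢ j (cong proj₂ e)
                  ; (there (here e)) → Cₘ.succ≢ j (cong proj₂ e) }) ,
               sideThreat (S ++ R) (Cₘ.Adj-succ j) (here refl) (∉S++R _) (side∉ (inj₁ refl)))
            ∷ ((side∉ (inj₂ refl) ,
                λ { (here e)         → Cₘ.pred≢ j (cong proj₂ e)
                  ; (there (here e)) → Cₘ.pred≢ j (cong proj₂ e) }) ,
               sideThreat (S ++ R) (Cₘ.Adj-pred j) (here refl) (∉S++R _) (side∉ (inj₂ refl)))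
            ∷ ((∉S++R r ,
                λ { (here e)         → C₃.pred≢ r (sym (cong proj₁ e))
                  ; (there (here e)) → C₃.succ≢ r (sym (cong proj₁ e)) }) ,
               column j , column-IsClique j , column⊆ , column∉)
            ∷ [] )) W
        where
        p₂ : Position G
        p₂ = colourRed G S p₁
        -- The first two complete horizontal edges at `v₂`; the third completes the column, where
        -- `v₁` and `v₂` are already blue.
        threats : List V
        threats = (pred r , succ j) ∷ (pred r , pred j) ∷ (r , j) ∷ []
        unique : Unique threats
        unique = (Cₘ.succ≢pred j ∘ cong proj₂ ∷ Cₘ.succ≢ j ∘ cong proj₂ ∷ []) ∷
                 (Cₘ.pred≢ j ∘ cong proj₂ ∷ []) ∷ [] ∷ []
        -- The two forced answers use up Alice's move of at most two vertices.
        ∉S : ∀ {w} → (succ r , succ j) ≢ w → (succ r , pred j) ≢ w → w ∉ S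
        ∉S {w} s≢w p≢w w∈S = <⇒≱ (s≤s (≤-trans (LegalMove⇒length≤ {G} legal) a≤2))
          (Unique-⊆⇒length≤ _≟×_
            ((Cₘ.succ≢pred j ∘ cong proj₂ ∷ s≢w ∷ []) ∷ (p≢w ∷ []) ∷ [] ∷ [])
            λ { (here refl) → s∈S ; (there (here refl)) → p∈S ; (there (there (here refl))) → w∈S })
        ∉S++R : ∀ g → (g , j) ∉ S ++ R
        ∉S++R g = [ ∉S (Cₘ.succ≢ j ∘ cong proj₂) (Cₘ.pred≢ j ∘ cong proj₂) , ∉R g ]′ ∘ ∈-++⁻ S
        side∉ : ∀ {h} → h ≡ succ j ⊎ h ≡ pred j → (pred r , h) ∉ S ++ R
        side∉ side = [ ∉S (C₃.succ≢pred r ∘ cong proj₁) (C₃.succ≢pred r ∘ cong proj₁)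
                     , side∉R (C₃.pred≢ r) side ]′ ∘ ∈-++⁻ S
        column∉ : All (_∉ S ++ R) (column j)
        column∉ = allColumn ∉S++R
        column⊆ : column j ⊆ (r , j) ∷ v₂ ∷ v₁ ∷ []
        column⊆ = All.lookup (allColumn inColumn)
          where
          inColumn : ∀ g → (g , j) ∈ (r , j) ∷ v₂ ∷ v₁ ∷ []
          inColumn g with r Fin.≟ g
          ... | yes refl = here refl
          ... | no r≢g with C₃.Adj⇒succ⊎pred (cycle₃-complete 3≤3 r≢g)
          ...   | inj₁ refl = there (there (here refl))
          ...   | inj₂ refl = there (here refl)

    startNotWon : Fin m → ¬ AliceWon G (start G)
    startNotWon j = unhit {G} (start G) (column-IsClique j) (All.tabulate (λ _ ()))

    bobWinsFirst : ∀ {a} → Fin m → a ≤ 2 → ¬ AliceWinsBobStart G a 1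
    bobWinsFirst j a≤2 = bobForks zero j a≤2 []

    bobWinsSecond : ∀ {a} → Fin m → a ≤ 2 →
                    (∀ S → length S ≤ a → ∃[ r ] ∃[ j ] All (Clear r j) S) →
                    ¬ AliceWinsAliceStart G a 1
    bobWinsSecond j _ _ (won w) = startNotWon j w
    bobWinsSecond _ a≤2 clearing (aliceMove _ S legal W) with clearing S (LegalMove⇒length≤ {G} legal)
    ... | r , j , clear = bobForks r j a≤2 (subst (All (Clear r j)) (sym (++-identityʳ S)) clear) W

    -- Bob may work in the column after the red vertex, whose row serves as `r`.
    clearOfOne : Fin m → ∀ S → length S ≤ 1 → ∃[ r ] ∃[ j ] All (Clear r j) S
    clearOfOne j []                 _  = zero , j , []
    clearOfOne _ ((g , h) ∷ [])     _  = g , succ h , (Cₘ.succ≢ h ∘ sym , inj₁ refl) ∷ []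
    clearOfOne _ (_ ∷ _ ∷ _)        (s≤s ())

    -- The row of the second vertex serves as `r`, so that vertex excludes only its own column. The
    -- first excludes its column and the two adjacent ones: four in all, and a fifth remains.
    clearOfTwo : 5 ≤ m → Fin m → ∀ S → length S ≤ 2 → ∃[ r ] ∃[ j ] All (Clear r j) S
    clearOfTwo _   j []         _ = clearOfOne j [] z≤n
    clearOfTwo _   j (x ∷ [])   _ = clearOfOne j (x ∷ []) ≤-refl
    clearOfTwo 5≤m _ ((_ , h) ∷ (g , k) ∷ []) _
      with fresh Fin._≟_ {ys = h ∷ succ h ∷ pred h ∷ k ∷ []} (Unique.allFin⁺ m)
             (≤-trans 5≤m (≤-reflexive (sym (length-tabulate {n = m} _))))
    ... | j , _ , j∉ = g , j ,
      ((λ e → j∉ (here (sym e))) , inj₂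
        ( (λ e → j∉ (there (there (here (trans (sym (Cₘ.pred-succ j)) (cong pred (sym e)))))))
        , (λ e → j∉ (there (here (trans (sym (Cₘ.succ-pred j)) (cong succ (sym e)))))))) ∷
      ((λ e → j∉ (there (there (there (here (sym e)))))) , inj₁ refl) ∷ []
    clearOfTwo _ _ (_ ∷ _ ∷ _ ∷ _) (s≤s (s≤s ()))

-- Evaluation on C_3 □ C_3.

module Prism₃ (p q : 3 ≤ 3) where

  open Prism p q
  open Graph G

  row : Fin 3 → List V
  row i = map (i ,_) (allFin 3)

  row-complete : ∀ i → Complete G (row i)
  row-complete i u∈ v∈ u≢v with ∈-map⁻ (i ,_) u∈ | ∈-map⁻ (i ,_) v∈
  ... | g , _ , refl | h , _ , refl = inj₂ (refl , cycle₃-complete q (u≢v ∘ cong (i ,_)))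

  lines : List (List V)
  lines = map column (allFin 3) ++ map row (allFin 3)

  -- A clique with two vertices in row `i` stays in that row, since a vertex elsewhere would have to
  -- lie in both of their columns.
  clique⊇line : ∀ {C} → IsClique G C → ∃[ L ] L ∈ lines × L ⊆ C
  clique⊇line {C} clique@(cC , maximal) with cliqueNonempty {G} (zero , zero) clique
  ... | (i , j) , ij∈C with splitClique clique ij∈C
  ...   | inj₂ col⊆C = column j , ∈-++⁺ˡ (∈-map⁺ column (∈-allFin j)) , col⊆C
  ...   | inj₁ (h , jh , ih∈C) =
    row i , ∈-++⁺ʳ (map column (allFin 3)) (∈-map⁺ row (∈-allFin i)) ,
    maximal (row i) (row-complete i) C⊆
    where
    C⊆ : C ⊆ row i
    C⊆ {g , k} x∈C with i Fin.≟ g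
    ... | yes refl = ∈-map⁺ (i ,_) (∈-allFin k)
    ... | no i≢g with cC ij∈C x∈C (i≢g ∘ cong proj₁) | cC ih∈C x∈C (i≢g ∘ cong proj₁)
    ...   | inj₁ (_ , refl) | inj₁ (_ , refl) = contradiction jh (Cycle.Adj-irrefl q)
    ...   | inj₂ (i≡g , _)  | _               = contradiction i≡g i≢g
    ...   | _               | inj₂ (i≡g , _)  = contradiction i≡g i≢g

  open Search {G} _≟×_ lines clique⊇line 1

  aliceWinsSecondAgainstOne : AliceWinsBobStart G 1 1
  -- The bound `9` is the number of vertices; `tt` is accepted because the search evaluates to a
  -- `just`.
  aliceWinsSecondAgainstOne = to-witness-T (searchBob 9 (start G)) tt

  aliceWinsFirstAgainstOne : AliceWinsAliceStart G 1 1
  aliceWinsFirstAgainstOne = to-witness-T (searchAlice 9 (greedy 1 (start G)) (start G)) tt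

-- Evaluation on C_3 □ C_4.

module Prism₄ (p : 3 ≤ 3) (q : 3 ≤ 4) where

  open Prism p q
  open Graph G

  edge : V → List V
  edge (i , j) = (i , j) ∷ (i , succ j) ∷ []

  lines : List (List V)
  lines = map column (allFin 4) ++ map edge vertices

  clique⊇line : ∀ {C} → IsClique G C → ∃[ L ] L ∈ lines × L ⊆ C
  clique⊇line {C} clique with cliqueNonempty {G} (zero , zero) clique
  ... | (i , j) , ij∈C with splitClique clique ij∈C
  ...   | inj₂ col⊆C = column j , ∈-++⁺ˡ (∈-map⁺ column (∈-allFin j)) , col⊆C
  ...   | inj₁ (h , jh , ih∈C) with Cycle.Adj⇒succ⊎pred q jh
  ...     | inj₁ refl =
    edge (i , j) , ∈-++⁺ʳ (map column (allFin 4)) (∈-map⁺ edge (enumeration (i , j))) ,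
    λ { (here refl) → ij∈C ; (there (here refl)) → ih∈C }
  ...     | inj₂ refl =
    -- A horizontal edge is listed only under the end whose successor is the other end, here
    -- `pred j`.
    edge (i , pred j) ,
    ∈-++⁺ʳ (map column (allFin 4)) (∈-map⁺ edge (enumeration (i , pred j))) ,
    λ { (here refl) → ih∈C
      ; (there (here refl)) → subst (λ k → (i , k) ∈ C) (sym (Cycle.succ-pred q j)) ij∈C }

  open Search {G} _≟×_ lines clique⊇line 2

  aliceWinsFirstAgainstTwo : AliceWinsAliceStart G 2 1
  aliceWinsFirstAgainstTwo =
    -- The opening uses opposite columns and different rows, so that no `r` and `j` make both
    -- vertices `Clear`.
    to-witness-T (searchAlice 9 ((# 0 , # 0) ∷ (# 1 , # 2) ∷ []) (start G)) tt

-- The thresholds.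

smallest : ∀ {P : ℕ → Set} {k} → P (suc k) → (∀ {a} → a ≤ k → ¬ P a) →
           IsSmallestPositive P (suc k)
smallest Pk minimal = s≤s z≤n , Pk , λ a _ Pa → ≮⇒≥ λ a<k → minimal (s≤s⁻¹ a<k) Pa

smallestOne : ∀ {P : ℕ → Set} → P 1 → IsSmallestPositive P 1
smallestOne P1 = ≤-refl , P1 , λ _ 1≤a _ → 1≤a

theorem4p1 : (n m : ℕ) (3≤n : 3 ≤ n) (n≤m : n ≤ m) →
    let G = cycle n 3≤n □ cycle m (≤-trans 3≤n n≤m) in
    ( (n ≡ 3 → m ≡ 3 → a₁[ G ]≡ 1)
    × (n ≡ 3 → m ≡ 4 → a₁[ G ]≡ 2)
    × (n ≡ 3 → 5 ≤ m → a₁[ G ]≡ 3)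
    × (4 ≤ n → a₁[ G ]≡ 4) )
    ×
    ( (n ≡ 3 → m ≡ 3 → a₁′[ G ]≡ 1)
    × (n ≡ 3 → 4 ≤ m → a₁′[ G ]≡ 3)
    × (4 ≤ n → a₁′[ G ]≡ 4) )
theorem4p1 n m 3≤n n≤m =
  ( (λ { refl refl → smallestOne (Prism₃.aliceWinsFirstAgainstOne 3≤n 3≤m) })
  , (λ { refl refl → smallest (Prism₄.aliceWinsFirstAgainstTwo 3≤n 3≤m) λ a≤1 →
        Prism.bobWinsSecond 3≤n 3≤m ≤-refl zero (≤-trans a≤1 (s≤s z≤n)) λ S S≤a →
          Prism.clearOfOne 3≤n 3≤m ≤-refl zero S (≤-trans S≤a a≤1) })
  , (λ { refl 5≤m → smallest (Prism.aliceWinsFirst 3≤n 3≤m (i₀ , j₀)) λ a≤2 →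
        Prism.bobWinsSecond 3≤n 3≤m (<⇒≤ 5≤m) j₀ a≤2 λ S S≤a →
          Prism.clearOfTwo 3≤n 3≤m (<⇒≤ 5≤m) 5≤m j₀ S (≤-trans S≤a a≤2) })
  , (λ 4≤n → smallest (Torus.aliceWinsFirst 3≤n 3≤m 4≤n (≤-trans 4≤n n≤m) (i₀ , j₀))
        (Torus.bobWinsSecond 3≤n 3≤m 4≤n (≤-trans 4≤n n≤m) (i₀ , j₀))) ) ,
  ( (λ { refl refl → smallestOne (Prism₃.aliceWinsSecondAgainstOne 3≤n 3≤m) })
  , (λ { refl 4≤m → smallest (Prism.aliceWinsSecond 3≤n 3≤m (i₀ , j₀))
        (Prism.bobWinsFirst 3≤n 3≤m 4≤m j₀) })
  , (λ 4≤n → smallest (Torus.aliceWinsSecond 3≤n 3≤m 4≤n (≤-trans 4≤n n≤m) (i₀ , j₀))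
        (Torus.bobWinsFirst 3≤n 3≤m 4≤n (≤-trans 4≤n n≤m) (i₀ , j₀))) )
  where
  3≤m = ≤-trans 3≤n n≤m
  i₀ : Fin n
  i₀ = fromℕ< 3≤n
  j₀ : Fin m
  j₀ = fromℕ< 3≤m
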